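{- For every formula $\psi\in\mathcal{L}_{pal}$, every Kripke model $\mathcal{M}$ and every world $w$ of $\mathcal{M}$, $$(\mathcal{M},w)\models\psi \iff (\mathcal{M},w)\models tr(\psi),$$ where $tr:\mathcal{L}_{pal}\to\mathcal{L}_{glal}$ is the translation that is the identity on atoms, commutes with $\neg$, $\land$ and $C_A$, and satisfies $tr([\phi]\phi')=[tr(\phi)]^+_{Ag}\,tr(\phi')$.
   Context: Languages. $AP$ is a set of atoms and $Ag$ a finite set of agents. For $p\in AP$ and $A\subseteq Ag$, the formulas of $\mathcal{L}_{glal}$ are $\psi ::= p \mid \neg\psi \mid \psi\land\psi \mid C_A\psi \mid [\psi]^+_A\psi \mid [\psi]^-_A\psi$, and the formulas of public announcement logic $\mathcal{L}_{pal}$ (PAL) are $\psi ::= p \mid \neg\psi \mid \psi\land\psi \mid C_A\psi \mid [\psi]\psi$. Models. A (Kripke) model is $\mathcal{M}=\langle W,\{R_a\}_{a\in Ag},V\rangle$ with $W$ a set of worlds, each $R_a$ an equivalence relation on $W$, and $V:AP\to 2^W$. For $w\in W$, $R_a(w)=\{w' : R_a(w,w')\}$; for $A\subseteq Ag$, $R^C_A=(\bigcup_{a\in A}R_a)^*$ is the reflexive-transitive closure and $R^C_A(w)=\{w' : R^C_A(w,w')\}$. Semantics. The satisfaction set $[\![\varphi]\!]_{\mathcal{M}}\subseteq W$ is defined by: $[\![p]\!]_{\mathcal{M}}=V(p)$; $[\![\neg\psi]\!]_{\mathcal{M}}=W\setminus[\![\psi]\!]_{\mathcal{M}}$; $[\![\psi\land\psi']\!]_{\mathcal{M}}=[\![\psi]\!]_{\mathcal{M}}\cap[\![\psi']\!]_{\mathcal{M}}$;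 $[\![C_A\psi]\!]_{\mathcal{M}}=\{w : R^C_A(w)\subseteq[\![\psi]\!]_{\mathcal{M}}\}$; for $\star\in\{+,-\}$, $[\![[\psi]^\star_A\psi']\!]_{\mathcal{M}}=\{w : \text{if } w\in[\![\psi]\!]_{\mathcal{M}} \text{ then } w\in[\![\psi']\!]_{\mathcal{M}^\star_{(w,\psi,A)}}\}$; and $[\![[\psi]\psi']\!]_{\mathcal{M}}=\{w : \text{if } w\in[\![\psi]\!]_{\mathcal{M}} \text{ then } w\in[\![\psi']\!]_{\mathcal{M}_\psi}\}$. The refinements $\mathcal{M}^-_{(w,\psi,A)}$ and $\mathcal{M}^+_{(w,\psi,A)}$ have the same worlds and valuation as $\mathcal{M}$ and relations $R^-_b=R^+_b=R_b$ for $b\notin A$, while for $a\in A$: $R^-_a(v)=R_a(v)\cap[\![\psi]\!]_{\mathcal{M}}$ if $v\in R_a(w)\cap[\![\psi]\!]_{\mathcal{M}}$; $R^-_a(v)=R_a(v)\cap[\![\neg\psi]\!]_{\mathcal{M}}$ if $v\in R_a(w)\cap[\![\neg\psi]\!]_{\mathcal{M}}$; $R^-_a(v)=R_a(v)$ otherwise; and $R^+_a(v)$ is defined by the same three cases with $R_a(w)$ replaced by $R^C_A(w)$ in the case conditions. The model $\mathcal{M}_\psi$ is the restriction of $\mathcal{M}$ to $[\![\psi]\!]_{\mathcal{M}}$: its worlds are $W\cap[\![\psi]\!]_{\mathcal{M}}$, its relations $R_a\cap([\![\psi]\!]_{\mathcal{M}}\times[\![\psi]\!]_{\mathcal{M}})$,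 its valuation $p\mapsto V(p)\cap[\![\psi]\!]_{\mathcal{M}}$. We write $(\mathcal{M},w)\models\varphi$ for $w\in[\![\varphi]\!]_{\mathcal{M}}$. -}

module Defs where

open import Axiom.ExcludedMiddle using (ExcludedMiddle)
open import Data.Empty using (⊥-elim)
open import Data.Fin using (Fin)
open import Data.Fin.Subset as Subset using (Subset)
open import Data.Fin.Subset.Properties using (_∈?_)
open import Data.Nat using (ℕ)
open import Data.Product using (Σ; ∃; _×_; _,_; proj₁)
open import Function using (_∘_)
open import Level using (Level; _⊔_) renaming (suc to lsuc)
open import Relation.Binary using (Rel; IsEquivalence)
open import Relation.Binary.Construct.Closure.ReflexiveTransitive using (Star; ε; _◅_; _◅◅_)
open import Relation.Nullary using (yes; no)
open import Relation.Unary using (Pred; _∈_; _∉_; _⊆_; _∩_; ∁)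

private
  variable
    α ℓ : Level
    AP : Set α
    n : ℕ

-- The finite set of agents is Fin n.
data GLAL (AP : Set α) (n : ℕ) : Set α where
  atom         : AP → GLAL AP n
  neg          : GLAL AP n → GLAL AP n
  _∧_          : GLAL AP n → GLAL AP n → GLAL AP n
  C            : Subset n → GLAL AP n → GLAL AP n
  [_]⁺_·_      : GLAL AP n → Subset n → GLAL AP n → GLAL AP n
  [_]⁻_·_      : GLAL AP n → Subset n → GLAL AP n → GLAL AP n

data PAL (AP : Set α) (n : ℕ) : Set α where
  atom         : AP → PAL AP n
  neg          : PAL AP n → PAL AP n
  _∧_          : PAL AP n → PAL AP n → PAL AP n
  C            : Subset n → PAL AP n → PAL AP n
  [_]_         : PAL AP n → PAL AP n → PAL AP n

tr : PAL AP n → GLAL AP n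
tr (atom p)  = atom p
tr (neg φ)   = neg (tr φ)
tr (φ ∧ φ′)  = tr φ ∧ tr φ′
tr (C A φ)   = C A (tr φ)
tr ([ φ ] φ′) = [ tr φ ]⁺ Subset.⊤ · tr φ′

-- Satisfaction does not depend on the relations being
-- equivalences, so it is defined on arbitrary relational structures.
-- Keeping the two apart avoids any appeal to excluded middle, which is
-- needed to show that refinements preserve reflexivity (see
-- refined-isEquivalence).
record Structure (AP : Set α) (n : ℕ) (ℓ : Level) : Set (α ⊔ lsuc ℓ) where
  field
    World : Set ℓ
    R     : Fin n → Rel World ℓ
    V     : AP → Pred World ℓ

  Rᶜ : Subset n → Rel World ℓ
  Rᶜ A = Star (λ v u → ∃ λ a → a Subset.∈ A × R a v u)

record IsKripke {AP : Set α} (M : Structure AP n ℓ) : Set ℓ where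
  open Structure M
  field
    isEquivalence : ∀ a → IsEquivalence (R a)

record KripkeModel (AP : Set α) (n : ℕ) (ℓ : Level) : Set (α ⊔ lsuc ℓ) where
  field
    structure : Structure AP n ℓ
    isKripke  : IsKripke structure
  open Structure structure public
  open IsKripke isKripke public

-- S a is the set of worlds whose a-successors are refined: R a w for
-- the update − and Rᶜ A w (for every a) for the update +.
module _ {W : Set ℓ} (R : Fin n → Rel W ℓ) (A : Subset n)
         (S : Fin n → Pred W ℓ) (P : Pred W ℓ) where

  data Refined (a : Fin n) (v u : W) : Set ℓ where
    unaffected : a Subset.∉ A → R a v u → Refined a v u
    positive   : a Subset.∈ A → v ∈ S a ∩ P →
                 u ∈ R a v ∩ P → Refined a v u
    negative   : a Subset.∈ A → v ∈ S a ∩ ∁ P →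
                 u ∈ R a v ∩ ∁ P → Refined a v u
    otherwise  : a Subset.∈ A → v ∉ S a ∩ P → v ∉ S a ∩ ∁ P →
                 R a v u → Refined a v u

module _ {AP : Set α} (M : Structure AP n ℓ) where
  open Structure M

  refine⁺ : World → Pred World ℓ → Subset n → Structure AP n ℓ
  refine⁺ w P A = record
    { World = World ; R = Refined R A (λ _ → Rᶜ A w) P ; V = V }

  refine⁻ : World → Pred World ℓ → Subset n → Structure AP n ℓ
  refine⁻ w P A = record
    { World = World ; R = Refined R A (λ a → R a w) P ; V = V }

  -- Relations and valuation ignore the membership proofs, so worlds
  -- differing only in that proof are indistinguishable.
  restrict : Pred World ℓ → Structure AP n ℓ
  restrict P = record
    { World = Σ World P
    ; R     = λ a v u → R a (proj₁ v) (proj₁ u)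
    ; V     = λ p v → V p (proj₁ v)
    }

open Structure

⟦_⟧ᵍ : GLAL AP n → (M : Structure AP n ℓ) → Pred (World M) ℓ
⟦ atom p ⟧ᵍ M         = V M p
⟦ neg φ ⟧ᵍ M          = ∁ (⟦ φ ⟧ᵍ M)
⟦ φ ∧ φ′ ⟧ᵍ M         = ⟦ φ ⟧ᵍ M ∩ ⟦ φ′ ⟧ᵍ M
⟦ C A φ ⟧ᵍ M          = λ w → Rᶜ M A w ⊆ ⟦ φ ⟧ᵍ M
⟦ [ φ ]⁺ A · φ′ ⟧ᵍ M  = λ w → w ∈ ⟦ φ ⟧ᵍ M → w ∈ ⟦ φ′ ⟧ᵍ (refine⁺ M w (⟦ φ ⟧ᵍ M) A)
⟦ [ φ ]⁻ A · φ′ ⟧ᵍ M  = λ w → w ∈ ⟦ φ ⟧ᵍ M → w ∈ ⟦ φ′ ⟧ᵍ (refine⁻ M w (⟦ φ ⟧ᵍ M) A)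

⟦_⟧ᵖ : PAL AP n → (M : Structure AP n ℓ) → Pred (World M) ℓ
⟦ atom p ⟧ᵖ M    = V M p
⟦ neg φ ⟧ᵖ M     = ∁ (⟦ φ ⟧ᵖ M)
⟦ φ ∧ φ′ ⟧ᵖ M    = ⟦ φ ⟧ᵖ M ∩ ⟦ φ′ ⟧ᵖ M
⟦ C A φ ⟧ᵖ M     = λ w → Rᶜ M A w ⊆ ⟦ φ ⟧ᵖ M
⟦ [ φ ] φ′ ⟧ᵖ M  = λ w → (w∈φ : w ∈ ⟦ φ ⟧ᵖ M) → (w , w∈φ) ∈ ⟦ φ′ ⟧ᵖ (restrict M (⟦ φ ⟧ᵖ M))

infix 4 _,_⊨ᵍ_ _,_⊨ᵖ_

_,_⊨ᵍ_ : (M : KripkeModel AP n ℓ) → KripkeModel.World M → GLAL AP n → Set ℓ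
M , w ⊨ᵍ φ = w ∈ ⟦ φ ⟧ᵍ (KripkeModel.structure M)

_,_⊨ᵖ_ : (M : KripkeModel AP n ℓ) → KripkeModel.World M → PAL AP n → Set ℓ
M , w ⊨ᵖ φ = w ∈ ⟦ φ ⟧ᵖ (KripkeModel.structure M)

-- Updates of Kripke models are Kripke models.  Excluded middle is used
-- only to know that the cases of Refined are exhaustive.
module _ {W : Set ℓ} {R : Fin n → Rel W ℓ} {A : Subset n}
         {S : Fin n → Pred W ℓ} {P : Pred W ℓ}
         (em : ExcludedMiddle ℓ)
         (equiv : ∀ a → IsEquivalence (R a))
         (closed : ∀ {a v u} → a Subset.∈ A → R a v u → v ∈ S a → u ∈ S a)
         where

  private
    module E a = IsEquivalence (equiv a)

    notS : ∀ {a v} → v ∉ S a ∩ P → v ∉ S a ∩ ∁ P → v ∉ S a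
    notS v∉₁ v∉₂ v∈S = v∉₂ (v∈S , λ v∈P → v∉₁ (v∈S , v∈P))

    reflexive : ∀ {a v} → Refined R A S P a v v
    reflexive {a} {v} with a ∈? A
    ... | no a∉A = unaffected a∉A (E.refl a)
    ... | yes a∈A with em {S a v} | em {P v}
    ...   | no v∉S  | _       = otherwise a∈A (v∉S ∘ proj₁) (v∉S ∘ proj₁) (E.refl a)
    ...   | yes v∈S | yes v∈P = positive a∈A (v∈S , v∈P) (E.refl a , v∈P)
    ...   | yes v∈S | no v∉P  = negative a∈A (v∈S , v∉P) (E.refl a , v∉P)

    symmetric : ∀ {a v u} → Refined R A S P a v u → Refined R A S P a u v
    symmetric {a} (unaffected a∉A r) = unaffected a∉A (E.sym a r)
    symmetric {a} (positive a∈A (v∈S , v∈P) (r , u∈P)) =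
      positive a∈A (closed a∈A r v∈S , u∈P) (E.sym a r , v∈P)
    symmetric {a} (negative a∈A (v∈S , v∉P) (r , u∉P)) =
      negative a∈A (closed a∈A r v∈S , u∉P) (E.sym a r , v∉P)
    symmetric {a} {v} {u} (otherwise a∈A v∉₁ v∉₂ r) =
      otherwise a∈A (u∉S ∘ proj₁) (u∉S ∘ proj₁) (E.sym a r)
      where
      u∉S : u ∉ S a
      u∉S = notS v∉₁ v∉₂ ∘ closed a∈A (E.sym a r)

    transitive : ∀ {a v u t} → Refined R A S P a v u → Refined R A S P a u t →
                 Refined R A S P a v t
    transitive {a} (unaffected a∉A r) (unaffected _ s) = unaffected a∉A (E.trans a r s)
    transitive (unaffected a∉A _) (positive a∈A _ _) = ⊥-elim (a∉A a∈A)
    transitive (unaffected a∉A _) (negative a∈A _ _) = ⊥-elim (a∉A a∈A)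
    transitive (unaffected a∉A _) (otherwise a∈A _ _ _) = ⊥-elim (a∉A a∈A)
    transitive (positive a∈A _ _) (unaffected a∉A _) = ⊥-elim (a∉A a∈A)
    transitive {a} (positive a∈A v∈ (r , _)) (positive _ _ (s , t∈P)) =
      positive a∈A v∈ (E.trans a r s , t∈P)
    transitive (positive _ _ (_ , u∈P)) (negative _ (_ , u∉P) _) = ⊥-elim (u∉P u∈P)
    transitive (positive a∈A (v∈S , _) (r , _)) (otherwise _ u∉₁ u∉₂ _) =
      ⊥-elim (notS u∉₁ u∉₂ (closed a∈A r v∈S))
    transitive (negative a∈A _ _) (unaffected a∉A _) = ⊥-elim (a∉A a∈A)
    transitive (negative _ _ (_ , u∉P)) (positive _ (_ , u∈P) _) = ⊥-elim (u∉P u∈P)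
    transitive {a} (negative a∈A v∈ (r , _)) (negative _ _ (s , t∉P)) =
      negative a∈A v∈ (E.trans a r s , t∉P)
    transitive (negative a∈A (v∈S , _) (r , _)) (otherwise _ u∉₁ u∉₂ _) =
      ⊥-elim (notS u∉₁ u∉₂ (closed a∈A r v∈S))
    transitive (otherwise a∈A _ _ _) (unaffected a∉A _) = ⊥-elim (a∉A a∈A)
    transitive {a} (otherwise a∈A v∉₁ v∉₂ r) (positive _ _ (s , _)) =
      otherwise a∈A v∉₁ v∉₂ (E.trans a r s)
    transitive {a} (otherwise a∈A v∉₁ v∉₂ r) (negative _ _ (s , _)) =
      otherwise a∈A v∉₁ v∉₂ (E.trans a r s)
    transitive {a} (otherwise a∈A v∉₁ v∉₂ r) (otherwise _ _ _ s) =
      otherwise a∈A v∉₁ v∉₂ (E.trans a r s)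

  refined-isEquivalence : ∀ a → IsEquivalence (Refined R A S P a)
  refined-isEquivalence a = record
    { refl = reflexive ; sym = symmetric ; trans = transitive }

module _ {AP : Set α} {M : Structure AP n ℓ} (kripke : IsKripke M) where
  open IsKripke kripke

  refine⁺-isKripke : ExcludedMiddle ℓ → ∀ w P A → IsKripke (refine⁺ M w P A)
  refine⁺-isKripke em w P A = record
    { isEquivalence = refined-isEquivalence em isEquivalence
        λ a∈A r w⟶v → w⟶v ◅◅ ((_ , a∈A , r) ◅ ε) }

  refine⁻-isKripke : ExcludedMiddle ℓ → ∀ w P A → IsKripke (refine⁻ M w P A)
  refine⁻-isKripke em w P A = record
    { isEquivalence = refined-isEquivalence em isEquivalence
        λ {a} _ r w⟶v → IsEquivalence.trans (isEquivalence a) w⟶v r }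

  restrict-isKripke : ∀ P → IsKripke (restrict M P)
  restrict-isKripke P = record
    { isEquivalence = λ a → record
        { refl  = IsEquivalence.refl (isEquivalence a)
        ; sym   = IsEquivalence.sym (isEquivalence a)
        ; trans = IsEquivalence.trans (isEquivalence a)
        } }

{-# OPTIONS --safe #-}

-- The submodel M_φ and the refinement N⁺_(v,φ,Ag) are bisimilar along the
-- φ-worlds reachable from v: refining cuts exactly the links that leave φ.
-- Invariance must therefore be proved for all bisimilar pairs at once, so that
-- the induction passes under announcements.
module Submission where

open import Data.Empty using (⊥-elim)
import Data.Fin.Subset as Subset
open import Data.Fin.Subset.Properties using (∈⊤)
open import Data.Nat using (ℕ)
open import Data.Product using (∃; _×_; _,_)
open import Data.Product.Function.NonDependent.Propositional using (_×-⇔_)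
open import Function using (_∘_; id)
open import Function.Bundles using (_⇔_; mk⇔; Equivalence)
open import Level using (Level; _⊔_)
open import Relation.Binary using (REL)
open import Relation.Binary.Construct.Closure.ReflexiveTransitive using (ε; _◅_; _◅◅_)
open import Relation.Binary.PropositionalEquality using (_≡_; refl)
open import Relation.Unary using (Pred; _∈_)
open import Defs

open Structure
open Equivalence using (to; from)

private
  variable
    α ℓ ℓ₁ ℓ₂ z : Level
    AP : Set α
    n : ℕ

-- Bare structures are related, rather than Kripke models, so that refinements can be compared
-- without first deciding which case of `Refined` applies.
record IsBisimulation {AP : Set α} (M : Structure AP n ℓ₁) (N : Structure AP n ℓ₂)
                      (Z : REL (World M) (World N) z) : Set (α ⊔ ℓ₁ ⊔ ℓ₂ ⊔ z) where
  field
    atoms : ∀ {w v} → Z w v → ∀ p → V M p w ⇔ V N p v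
    forth : ∀ {a w v w′} → Z w v → R M a w w′ → ∃ λ v′ → R N a v v′ × Z w′ v′
    back  : ∀ {a w v v′} → Z w v → R N a v v′ → ∃ λ w′ → R M a w w′ × Z w′ v′

open IsBisimulation

≡-isBisimulation : (M : Structure AP n ℓ) → IsBisimulation M M _≡_
≡-isBisimulation M = record
  { atoms = λ { refl _ → mk⇔ id id }
  ; forth = λ { refl r → _ , r , refl }
  ; back  = λ { refl r → _ , r , refl }
  }

module _ {M : Structure AP n ℓ₁} {N : Structure AP n ℓ₂}
         {Z : REL (World M) (World N) z} (bisim : IsBisimulation M N Z) where

  forthᶜ : ∀ {A w v w′} → Z w v → Rᶜ M A w w′ → ∃ λ v′ → Rᶜ N A v v′ × Z w′ v′
  forthᶜ wZv ε = _ , ε , wZv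
  forthᶜ wZv ((a , a∈A , r) ◅ rs) with forth bisim wZv r
  ... | _ , s , uZx with forthᶜ uZx rs
  ...   | _ , ss , w′Zv′ = _ , (a , a∈A , s) ◅ ss , w′Zv′

  backᶜ : ∀ {A w v v′} → Z w v → Rᶜ N A v v′ → ∃ λ w′ → Rᶜ M A w w′ × Z w′ v′
  backᶜ wZv ε = _ , ε , wZv
  backᶜ wZv ((a , a∈A , s) ◅ ss) with back bisim wZv s
  ... | _ , r , uZx with backᶜ uZx ss
  ...   | _ , rs , w′Zv′ = _ , (a , a∈A , r) ◅ rs , w′Zv′

  -- The membership proof is ignored: restricted worlds differing only in it behave alike.
  -- Reachability is recorded because refining at `v₀` cuts links only at worlds reachable from
  -- `v₀`; elsewhere a link leaving the announced set could survive and break `back`.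
  AnnouncementRel : (P : Pred (World M) ℓ₁) → World N → REL (World (restrict M P)) (World N) _
  AnnouncementRel P v₀ (w , _) v = Z w v × Rᶜ N Subset.⊤ v₀ v

  -- A link of the restriction has both ends in `P`, so its match has both ends in `Q` and survives
  -- as `positive`. Conversely, a refined link from a reachable `Q`-world ends in `Q`, so its match
  -- ends in `P`.
  announcement-isBisimulation :
    {P : Pred (World M) ℓ₁} {Q : Pred (World N) ℓ₂} →
    (∀ {w v} → Z w v → w ∈ P ⇔ v ∈ Q) → (v₀ : World N) →
    IsBisimulation (restrict M P) (refine⁺ N v₀ Q Subset.⊤) (AnnouncementRel P v₀)
  announcement-isBisimulation {P} {Q} P⇔Q v₀ = record
    { atoms = λ (wZv , _) → atoms bisim wZv
    ; forth = λ {_} {w} {_} {w′} → forth′ {w = w} {w′ = w′}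
    ; back  = λ {_} {w} → back′ {w = w}
    }
    where
    M′ = restrict M P
    N′ = refine⁺ N v₀ Q Subset.⊤
    Z′ = AnnouncementRel P v₀

    forth′ : ∀ {a w v w′} → Z′ w v → R M′ a w w′ → ∃ λ v′ → R N′ a v v′ × Z′ w′ v′
    forth′ {w = _ , w∈P} {w′ = _ , w′∈P} (wZv , v₀⟶v) r with forth bisim wZv r
    ... | _ , s , w′Zv′ =
      _ , positive ∈⊤ (v₀⟶v , to (P⇔Q wZv) w∈P) (s , to (P⇔Q w′Zv′) w′∈P)
        , w′Zv′ , v₀⟶v ◅◅ ((_ , ∈⊤ , s) ◅ ε)

    back′ : ∀ {a w v v′} → Z′ w v → R N′ a v v′ → ∃ λ w′ → R M′ a w w′ × Z′ w′ v′
    back′ _ (unaffected a∉⊤ _) = ⊥-elim (a∉⊤ ∈⊤)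
    back′ (wZv , v₀⟶v) (positive _ _ (s , v′∈Q)) with back bisim wZv s
    ... | _ , r , w′Zv′ =
      (_ , from (P⇔Q w′Zv′) v′∈Q) , r , w′Zv′ , v₀⟶v ◅◅ ((_ , ∈⊤ , s) ◅ ε)
    back′ {w = _ , w∈P} (wZv , _) (negative _ (_ , v∉Q) _) =
      ⊥-elim (v∉Q (to (P⇔Q wZv) w∈P))
    -- Reachability excludes uncut links: `v` is reachable from `v₀` and lies in `Q`.
    back′ {w = _ , w∈P} (wZv , v₀⟶v) (otherwise _ v∉₁ _ _) =
      ⊥-elim (v∉₁ (v₀⟶v , to (P⇔Q wZv) w∈P))

-- `Z` and its level vary through the induction: each announcement passes to `AnnouncementRel`,
-- which conjoins reachability in `N`.
tr-invariant : {M : Structure AP n ℓ₁} {N : Structure AP n ℓ₂}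
  {Z : REL (World M) (World N) z} → IsBisimulation M N Z →
  (ψ : PAL AP n) → ∀ {w v} → Z w v → w ∈ ⟦ ψ ⟧ᵖ M ⇔ v ∈ ⟦ tr ψ ⟧ᵍ N
tr-invariant bisim (atom p) wZv = atoms bisim wZv p
tr-invariant bisim (neg φ) wZv = mk⇔ (_∘ from φ⇔) (_∘ to φ⇔)
  where φ⇔ = tr-invariant bisim φ wZv
tr-invariant bisim (φ ∧ φ′) wZv =
  tr-invariant bisim φ wZv ×-⇔ tr-invariant bisim φ′ wZv
tr-invariant {M = M} {N} bisim (C A φ) {w} {v} wZv = mk⇔ to′ from′
  where
  to′ : w ∈ ⟦ C A φ ⟧ᵖ M → v ∈ ⟦ tr (C A φ) ⟧ᵍ N
  -- The claim about all paths from `w` transfers to `v` by pulling each path of `N` back to `M`.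
  to′ h ss with backᶜ bisim wZv ss
  ... | _ , rs , w′Zv′ = to (tr-invariant bisim φ w′Zv′) (h rs)

  from′ : v ∈ ⟦ tr (C A φ) ⟧ᵍ N → w ∈ ⟦ C A φ ⟧ᵖ M
  from′ h rs with forthᶜ bisim wZv rs
  ... | _ , ss , w′Zv′ = from (tr-invariant bisim φ w′Zv′) (h ss)
tr-invariant {M = M} {N} bisim ([ φ ] φ′) {w} {v} wZv = mk⇔
  (λ h v∈φ → to (φ′⇔ (from φ⇔ v∈φ)) (h (from φ⇔ v∈φ)))
  (λ h w∈φ → from (φ′⇔ w∈φ) (h (to φ⇔ w∈φ)))
  where
  φ⇔ = tr-invariant bisim φ wZv

  φ′⇔ : (w∈φ : w ∈ ⟦ φ ⟧ᵖ M) →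
        (w , w∈φ) ∈ ⟦ φ′ ⟧ᵖ (restrict M (⟦ φ ⟧ᵖ M)) ⇔
        v ∈ ⟦ tr φ′ ⟧ᵍ (refine⁺ N v (⟦ tr φ ⟧ᵍ N) Subset.⊤)
  -- Here the induction hypothesis for `φ` is used at all related pairs, not only at `w` and `v`.
  -- The refinement is pointed at `v` itself, so the empty path `ε` gives reachability.
  φ′⇔ _ = tr-invariant
    (announcement-isBisimulation bisim (tr-invariant bisim φ) v) φ′ (wZv , ε)

proposition2 : {α ℓ : Level} {AP : Set α} {n : ℕ}
    (ψ : PAL AP n) (M : KripkeModel AP n ℓ) (w : KripkeModel.World M) →
    (M , w ⊨ᵖ ψ) ⇔ (M , w ⊨ᵍ tr ψ)
proposition2 ψ M w = tr-invariant (≡-isBisimulation (KripkeModel.structure M)) ψ refl
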